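{- The simple minor relation $\preceq$ between hypergraphs is a quasi-order (i.e. it is reflexive and transitive).
   Context: A hypergraph is a pair $\mathcal{H}=(V,\mathcal{E})$ with $V$ a finite nonempty set and $\mathcal{E}$ a set of subsets of $V$ (the empty set is allowed as a hyperedge). A map $h':V'\to V$ is a quotient map from $\mathcal{H}'=(V',\mathcal{E}')$ to $\mathcal{H}=(V,\mathcal{E})$ if for every $E\subseteq V$: $E\in\mathcal{E}$ if and only if the number of $E'\in\mathcal{E}'$ with $h'(E')=E$ (image set) is odd. $\mathcal{H}$ is a simple minor of $\mathcal{H}'$, written $\mathcal{H}\preceq\mathcal{H}'$, if there is a quotient map from $\mathcal{H}'$ to $\mathcal{H}$. -}

module Defs where

open import Data.Bool.Properties using () renaming (_≟_ to _≟ᵇ_)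
open import Data.Fin.Base using (Fin)
open import Data.Fin.Properties using (any?) renaming (_≟_ to _≟ᶠ_)
open import Data.Fin.Subset using (Subset; inside; outside; _∈_)
open import Data.Fin.Subset.Properties using (_∈?_)
open import Data.List.Base using (List; []; _∷_; _++_; map; filter; length)
open import Data.List.Membership.Propositional using () renaming (_∈_ to _∈ˡ_)
open import Data.List.Membership.Propositional.Properties
  using (∈-map⁺; ∈-map⁻; ∈-++⁺ˡ; ∈-++⁺ʳ)
open import Data.List.Relation.Unary.All using ([])
open import Data.List.Relation.Unary.AllPairs using ([]; _∷_)
open import Data.List.Relation.Unary.Any using (here)
open import Data.List.Relation.Unary.Unique.Propositional using (Unique)
open import Data.List.Relation.Unary.Unique.Propositional.Properties using (map⁺; ++⁺)
open import Data.Nat.Base using (ℕ; zero; suc; NonZero; parity)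
open import Data.Parity.Base using (1ℙ)
open import Data.Product.Base using (∃; _×_; _,_)
open import Data.Vec.Base using ([]; _∷_; tabulate)
open import Data.Vec.Properties using (≡-dec; ∷-injectiveʳ; lookup⇒[]=; []=⇒lookup; lookup∘tabulate)
open import Function.Base using (_∘_)
open import Function.Bundles using (_↔_; _⇔_; mk⇔; Inverse)
open import Level using (Level; 0ℓ) renaming (suc to lsuc)
open import Relation.Binary.Core using (Rel)
open import Relation.Binary.PropositionalEquality using (_≡_; refl; sym; trans; cong; subst)
open import Relation.Nullary.Decidable using (Dec; yes; does; _×-dec_; dec-true)
open import Relation.Unary using (Pred; Decidable)

private
  variable
    a : Level
    n : ℕ

-- A subset of V is given by its characteristic vector along the enumeration
-- of V, so that equality of subsets is _≡_; see _∈ⱽ_.  Decidability of 𝓔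
-- is what makes it possible to count hyperedges constructively.
record Hypergraph a : Set (lsuc a) where
  field
    V            : Set a
    order        : ℕ
    enumeration  : V ↔ Fin order
    nonempty     : NonZero order
    𝓔            : Pred (Subset order) 0ℓ
    𝓔?           : Decidable 𝓔

  open Inverse enumeration public using ()
    renaming (to to index; from to vertex; strictlyInverseˡ to index∘vertex;
              strictlyInverseʳ to vertex∘index)

  infix 4 _∈ⱽ_
  _∈ⱽ_ : V → Subset order → Set
  v ∈ⱽ E = index v ∈ E

subsets : ∀ n → List (Subset n)
subsets zero    = [] ∷ []
subsets (suc n) = map (inside ∷_) (subsets n) ++ map (outside ∷_) (subsets n)

subsets-complete : (p : Subset n) → p ∈ˡ subsets n
subsets-complete []            = here refl
subsets-complete (inside  ∷ p) = ∈-++⁺ˡ (∈-map⁺ (inside ∷_) (subsets-complete p))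
subsets-complete (outside ∷ p) =
  ∈-++⁺ʳ (map (inside ∷_) (subsets _)) (∈-map⁺ (outside ∷_) (subsets-complete p))

subsets-unique : ∀ n → Unique (subsets n)
subsets-unique zero    = [] ∷ []
subsets-unique (suc n) =
  ++⁺ (map⁺ ∷-injectiveʳ (subsets-unique n)) (map⁺ ∷-injectiveʳ (subsets-unique n)) λ
    { (p , q) → case (∈-map⁻ (inside ∷_) p) (∈-map⁻ (outside ∷_) q) }
  where
  open import Data.Empty using (⊥)
  case : ∀ {v : Subset (suc n)} →
         ∃ (λ x → x ∈ˡ subsets n × v ≡ inside ∷ x) →
         ∃ (λ x → x ∈ˡ subsets n × v ≡ outside ∷ x) → ⊥
  case (_ , _ , refl) (_ , _ , ())

Odd : ℕ → Set
Odd k = parity k ≡ 1ℙ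

module _ (ℋ′ ℋ : Hypergraph a) where
  private
    module H′ = Hypergraph ℋ′
    module H  = Hypergraph ℋ

  hits? : (h : H′.V → H.V) (E′ : Subset H′.order) (i : Fin H.order) →
          Dec (∃ λ j → j ∈ E′ × H.index (h (H′.vertex j)) ≡ i)
  hits? h E′ i = any? λ j → j ∈? E′ ×-dec H.index (h (H′.vertex j)) ≟ᶠ i

  image : (H′.V → H.V) → Subset H′.order → Subset H.order
  image h E′ = tabulate (does ∘ hits? h E′)

  ∈-image : ∀ h E′ v → v H.∈ⱽ image h E′ ⇔ (∃ λ v′ → v′ H′.∈ⱽ E′ × h v′ ≡ v)
  ∈-image h E′ v = mk⇔ to from
    where
    i = H.index v
    to : v H.∈ⱽ image h E′ → ∃ λ v′ → v′ H′.∈ⱽ E′ × h v′ ≡ v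
    to v∈ with hits? h E′ i | trans (sym (lookup∘tabulate (does ∘ hits? h E′) i)) ([]=⇒lookup v∈)
    ... | yes (j , j∈ , eq) | _ =
      H′.vertex j , subst (_∈ E′) (sym (H′.index∘vertex j)) j∈ ,
      trans (sym (H.vertex∘index _)) (trans (cong H.vertex eq) (H.vertex∘index v))
    from : (∃ λ v′ → v′ H′.∈ⱽ E′ × h v′ ≡ v) → v H.∈ⱽ image h E′
    from (v′ , v′∈ , refl) = lookup⇒[]= i _
      (trans (lookup∘tabulate (does ∘ hits? h E′) i)
        (dec-true (hits? h E′ i) (H′.index v′ , v′∈ , cong (H.index ∘ h) (H′.vertex∘index v′))))

  preimageCount : (H′.V → H.V) → Subset H.order → ℕ
  preimageCount h E =
    length (filter (λ E′ → H′.𝓔? E′ ×-dec ≡-dec _≟ᵇ_ (image h E′) E) (subsets H′.order))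

  IsQuotientMap : (H′.V → H.V) → Set
  IsQuotientMap h = ∀ E → H.𝓔 E ⇔ Odd (preimageCount h E)

infix 4 _⪯_
_⪯_ : Rel (Hypergraph a) a
ℋ ⪯ ℋ′ = ∃ λ h → IsQuotientMap ℋ′ ℋ h

{-# OPTIONS --safe #-}
-- Let [_] be the indicator with values in 𝔽₂ = Parity.  A map h is a quotient
-- map iff [E ∈ 𝓔] = ∑_{E′} [E′ ∈ 𝓔′] [h(E′) = E] for every E, i.e. iff the
-- indicator of 𝓔 is the push-forward of that of 𝓔′ along the image map.
-- Push-forward is functorial: taking images is, and the two sums that arise
-- for a composition can be interchanged.
module Submission where

open import Defs
open import Algebra.Bundles using (Semiring)
open import Data.Bool.Base using (true; false; if_then_else_)
open import Data.Bool.Properties using () renaming (_≟_ to _≟ᵇ_)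
open import Data.Fin.Subset using (Subset; _⊆_)
import Data.Fin.Subset as Subset
open import Data.Fin.Subset.Properties using (⊆-antisym)
open import Data.List.Base using (List; []; _∷_; filter; length; lookup)
open import Data.List.Membership.Propositional using (_∈_; _∉_)
open import Data.List.Relation.Unary.All as All using ()
open import Data.List.Relation.Unary.AllPairs using (_∷_)
open import Data.List.Relation.Unary.Any using (here; there)
open import Data.List.Relation.Unary.Unique.Propositional using (Unique)
open import Data.Nat.Base using (ℕ; parity)
open import Data.Parity.Base using (Parity; 0ℙ; 1ℙ; _+_; _*_)
open import Data.Parity.Properties
  using (+-*-semiring; +-identityʳ; *-assoc; *-comm; +-homo-+)
open import Data.Product.Base using (_,_)
open import Data.Vec.Properties using (≡-dec)
open import Function.Base using (id; _∘_)
open import Function.Bundles using (_⇔_; mk⇔; Equivalence)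
open import Level using (Level)
open import Relation.Binary.Definitions using (DecidableEquality)
open import Relation.Binary.PropositionalEquality
  using (_≡_; refl; sym; trans; cong; cong₂; subst; isEquivalence; module ≡-Reasoning)
open import Relation.Binary.Structures using (IsPreorder)
open import Relation.Nullary using (Dec; yes; no; does; ¬_; contradiction)
open import Relation.Nullary.Decidable using (_×-dec_; does-⇔; dec-true; dec-false)
open import Relation.Unary using (Pred; Decidable)

import Algebra.Properties.CommutativeMonoid.Sum as CommutativeMonoidSum
import Algebra.Properties.Semiring.Sum as SemiringSum

open CommutativeMonoidSum (Semiring.+-commutativeMonoid +-*-semiring) using (∑-comm)
open SemiringSum +-*-semiring using (sum; sum-cong-≗; *-distribˡ-sum; *-distribʳ-sum)
open Equivalence using (to; from)
open ≡-Reasoning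

private
  variable
    a b p q : Level
    A : Set a
    B : Set b
    P : Set p
    Q : Set q
    n : ℕ

[_] : Dec P → Parity
[ P? ] = if does P? then 1ℙ else 0ℙ

[]-cong : P ⇔ Q → (P? : Dec P) (Q? : Dec Q) → [ P? ] ≡ [ Q? ]
[]-cong P⇔Q P? Q? = cong (if_then 1ℙ else 0ℙ) (does-⇔ P⇔Q P? Q?)

[]-true : (P? : Dec P) → P → [ P? ] ≡ 1ℙ
[]-true P? = cong (if_then 1ℙ else 0ℙ) ∘ dec-true P?

[]-false : (P? : Dec P) → ¬ P → [ P? ] ≡ 0ℙ
[]-false P? = cong (if_then 1ℙ else 0ℙ) ∘ dec-false P?

[]-× : (P? : Dec P) (Q? : Dec Q) → [ P? ×-dec Q? ] ≡ [ P? ] * [ Q? ]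
[]-× P? Q? with does P?
... | true  = refl
... | false = refl

-- Together with its converse `⇔⇒[]≡`, this trades the logical equivalence in `IsQuotientMap` for an
-- equation in 𝔽₂, after which only algebra with sums remains.
[]≡⇒⇔ : (P? : Dec P) {x : Parity} → [ P? ] ≡ x → P ⇔ x ≡ 1ℙ
[]≡⇒⇔ (yes p) refl = mk⇔ (λ _ → refl) (λ _ → p)
[]≡⇒⇔ (no ¬p) refl = mk⇔ (λ p → contradiction p ¬p) λ ()

-- `Parity` has just two elements, so knowing when `x` is `1ℙ` determines `x`.
⇔⇒[]≡ : (P? : Dec P) (x : Parity) → P ⇔ x ≡ 1ℙ → [ P? ] ≡ x
⇔⇒[]≡ P?      1ℙ P⇔ = []-true P? (from P⇔ refl)
-- This case is contradictory, but `to P⇔ p : 0ℙ ≡ 1ℙ` read backwards is already the goal.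
⇔⇒[]≡ (yes p) 0ℙ P⇔ = sym (to P⇔ p)
⇔⇒[]≡ (no _)  0ℙ P⇔ = refl

-- Going through positions in the list makes this a sum over `Fin (length xs)`, so interchange and
-- distributivity are inherited from the general theory of finite sums in a semiring.
∑ : List A → (A → Parity) → Parity
∑ xs f = sum (f ∘ lookup xs)

syntax ∑ xs (λ x → t) = ∑[ x ∈ xs ] t

∑-cong : (xs : List A) {f g : A → Parity} → (∀ x → f x ≡ g x) → ∑ xs f ≡ ∑ xs g
∑-cong xs f≗g = sum-cong-≗ (f≗g ∘ lookup xs)

∑-swap : (xs : List A) (ys : List B) (f : A → B → Parity) →
         ∑[ x ∈ xs ] ∑[ y ∈ ys ] f x y ≡ ∑[ y ∈ ys ] ∑[ x ∈ xs ] f x y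
∑-swap xs ys f = ∑-comm λ i j → f (lookup xs i) (lookup ys j)

∑-*ˡ : (xs : List A) (c : Parity) (f : A → Parity) → c * ∑ xs f ≡ ∑[ x ∈ xs ] (c * f x)
∑-*ˡ xs c f = *-distribˡ-sum c (f ∘ lookup xs)

∑-*ʳ : (xs : List A) (c : Parity) (f : A → Parity) → ∑ xs f * c ≡ ∑[ x ∈ xs ] (f x * c)
∑-*ʳ xs c f = *-distribʳ-sum c (f ∘ lookup xs)

-- `parity` is additive, so each entry that passes the filter contributes one `1ℙ`.
parity-length-filter : {P : Pred A p} (P? : Decidable P) (xs : List A) →
                       parity (length (filter P? xs)) ≡ ∑[ x ∈ xs ] [ P? x ]
parity-length-filter P? [] = refl
parity-length-filter P? (x ∷ xs) with does (P? x)
... | true  = trans (+-homo-+ 1 (length (filter P? xs))) (cong (1ℙ +_) (parity-length-filter P? xs))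
... | false = parity-length-filter P? xs

module _ (_≟_ : DecidableEquality A) (f : A → Parity) {y : A} where

  ∑-δ-∉ : ∀ {xs} → y ∉ xs → ∑[ x ∈ xs ] ([ y ≟ x ] * f x) ≡ 0ℙ
  ∑-δ-∉ {[]}     y∉ = refl
  ∑-δ-∉ {x ∷ xs} y∉ =
    cong₂ _+_ (cong (_* f x) ([]-false (y ≟ x) (y∉ ∘ here))) (∑-δ-∉ (y∉ ∘ there))

  -- Uniqueness matters: modulo 2, a second occurrence of `y` would cancel the first. Past the only
  -- occurrence, the tail vanishes by `∑-δ-∉`.
  ∑-δ : ∀ {xs} → Unique xs → y ∈ xs → ∑[ x ∈ xs ] ([ y ≟ x ] * f x) ≡ f y
  ∑-δ (y≢ ∷ _) (here refl) = trans
    (cong₂ _+_ (cong (_* f y) ([]-true (y ≟ y) refl))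
               (∑-δ-∉ λ y∈ → All.lookup y≢ y∈ refl))
    (+-identityʳ (f y))
  ∑-δ {x ∷ _} (x≢ ∷ u) (there y∈) =
    cong₂ _+_ (cong (_* f x) ([]-false (y ≟ x) (All.lookup x≢ y∈ ∘ sym))) (∑-δ u y∈)

infix 4 _≟ˢ_
_≟ˢ_ : DecidableEquality (Subset n)
_≟ˢ_ = ≡-dec _≟ᵇ_

∑-subsets-δ : (E : Subset n) (f : Subset n → Parity) →
              ∑[ F ∈ subsets n ] ([ E ≟ˢ F ] * f F) ≡ f E
∑-subsets-δ E f = ∑-δ _≟ˢ_ f (subsets-unique _) (subsets-complete E)

module _ (ℋ : Hypergraph a) where
  open Hypergraph ℋ

  -- Every position `i` is the index of the vertex `vertex i`, so testing on vertices is enough.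
  -- This lets images be compared through `∈-image` alone, without unfolding characteristic vectors.
  ⊆-fromⱽ : ∀ {E F} → (∀ v → v ∈ⱽ E → v ∈ⱽ F) → E ⊆ F
  ⊆-fromⱽ {E} {F} E⊆F {i} i∈E = subst (Subset._∈ F) (index∘vertex i)
    (E⊆F (vertex i) (subst (Subset._∈ E) (sym (index∘vertex i)) i∈E))

  ≡-fromⱽ : ∀ {E F} → (∀ v → v ∈ⱽ E ⇔ v ∈ⱽ F) → E ≡ F
  ≡-fromⱽ E⇔F = ⊆-antisym (⊆-fromⱽ (to ∘ E⇔F)) (⊆-fromⱽ (from ∘ E⇔F))

  image-id : ∀ E → image ℋ ℋ id E ≡ E
  image-id E = ≡-fromⱽ λ v → mk⇔
    (λ v∈ → let _ , w∈ , w≡v = to (∈-image ℋ ℋ id E v) v∈ in subst (_∈ⱽ E) w≡v w∈)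
    (λ v∈ → from (∈-image ℋ ℋ id E v) (v , v∈ , refl))

module _ (ℋ″ ℋ′ ℋ : Hypergraph a)
         (h : Hypergraph.V ℋ″ → Hypergraph.V ℋ′) (g : Hypergraph.V ℋ′ → Hypergraph.V ℋ) where

  -- Both inclusions pass through an intermediate vertex of `ℋ′`: given a preimage `u` under
  -- `g ∘ h`, it is `h u`.
  image-∘ : ∀ E → image ℋ′ ℋ g (image ℋ″ ℋ′ h E) ≡ image ℋ″ ℋ (g ∘ h) E
  image-∘ E = ≡-fromⱽ ℋ λ v → mk⇔
    (λ v∈ → let w , w∈ , gw≡v = to (∈-image ℋ′ ℋ g _ v) v∈
                u , u∈ , hu≡w = to (∈-image ℋ″ ℋ′ h E w) w∈
            in from (∈-image ℋ″ ℋ (g ∘ h) E v) (u , u∈ , trans (cong g hu≡w) gw≡v))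
    (λ v∈ → let u , u∈ , ghu≡v = to (∈-image ℋ″ ℋ (g ∘ h) E v) v∈
            in from (∈-image ℋ′ ℋ g _ v)
                 (h u , from (∈-image ℋ″ ℋ′ h E (h u)) (u , u∈ , refl) , ghu≡v))

module _ (ℋ′ ℋ : Hypergraph a) (h : Hypergraph.V ℋ′ → Hypergraph.V ℋ) where
  private
    module H′ = Hypergraph ℋ′
    module H  = Hypergraph ℋ

  pushforward : Subset H.order → Parity
  pushforward E = ∑[ E′ ∈ subsets H′.order ] ([ H′.𝓔? E′ ] * [ image ℋ′ ℋ h E′ ≟ˢ E ])

  parity-preimageCount : ∀ E → parity (preimageCount ℋ′ ℋ h E) ≡ pushforward E
  parity-preimageCount E = trans
    (parity-length-filter (λ E′ → H′.𝓔? E′ ×-dec image ℋ′ ℋ h E′ ≟ˢ E) (subsets _))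
    (∑-cong (subsets _) λ E′ → []-× (H′.𝓔? E′) (image ℋ′ ℋ h E′ ≟ˢ E))

  isQuotientMap⇒[]≡pushforward : IsQuotientMap ℋ′ ℋ h → ∀ E → [ H.𝓔? E ] ≡ pushforward E
  isQuotientMap⇒[]≡pushforward quot E =
    trans (⇔⇒[]≡ (H.𝓔? E) _ (quot E)) (parity-preimageCount E)

  []≡pushforward⇒isQuotientMap : (∀ E → [ H.𝓔? E ] ≡ pushforward E) → IsQuotientMap ℋ′ ℋ h
  []≡pushforward⇒isQuotientMap eq E =
    []≡⇒⇔ (H.𝓔? E) (trans (eq E) (sym (parity-preimageCount E)))

id-isQuotientMap : (ℋ : Hypergraph a) → IsQuotientMap ℋ ℋ id
id-isQuotientMap ℋ = []≡pushforward⇒isQuotientMap ℋ ℋ id λ E → sym (begin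
  ∑[ F ∈ subsets order ] ([ 𝓔? F ] * [ image ℋ ℋ id F ≟ˢ E ])
    -- Since the image under `id` is `F` itself, the second factor is the Kronecker delta of `E` and
    -- `F`. It is moved to the left to match `∑-subsets-δ`.
    ≡⟨ ∑-cong (subsets _) (λ F → trans (*-comm [ 𝓔? F ] _) (cong (_* [ 𝓔? F ])
         ([]-cong (mk⇔ (λ eq → trans (sym eq) (image-id ℋ F)) (λ eq → trans (image-id ℋ F) (sym eq)))
           (image ℋ ℋ id F ≟ˢ E) (E ≟ˢ F)))) ⟩
  ∑[ F ∈ subsets order ] ([ E ≟ˢ F ] * [ 𝓔? F ])
    ≡⟨ ∑-subsets-δ E ([_] ∘ 𝓔?) ⟩
  [ 𝓔? E ] ∎)
  where open Hypergraph ℋ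

∘-isQuotientMap : (ℋ″ ℋ′ ℋ : Hypergraph a) →
                  ∀ h g → IsQuotientMap ℋ″ ℋ′ h → IsQuotientMap ℋ′ ℋ g →
                  IsQuotientMap ℋ″ ℋ (g ∘ h)
∘-isQuotientMap ℋ″ ℋ′ ℋ h g h-quot g-quot =
  []≡pushforward⇒isQuotientMap ℋ″ ℋ (g ∘ h) λ E → begin
  [ H.𝓔? E ]
    ≡⟨ isQuotientMap⇒[]≡pushforward ℋ′ ℋ g g-quot E ⟩
  ∑[ F ∈ Fs ] ([ H′.𝓔? F ] * [ g[ F ] ≟ˢ E ])
    -- The indicator of the middle hypergraph is itself a push-forward along `h`, which produces the
    -- double sum.
    ≡⟨ ∑-cong Fs (λ F → cong (_* [ g[ F ] ≟ˢ E ])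
         (isQuotientMap⇒[]≡pushforward ℋ″ ℋ′ h h-quot F)) ⟩
  ∑[ F ∈ Fs ] (∑[ G ∈ Gs ] ([ H″.𝓔? G ] * [ h[ G ] ≟ˢ F ]) * [ g[ F ] ≟ˢ E ])
    ≡⟨ ∑-cong Fs (λ F → trans
         (∑-*ʳ Gs [ g[ F ] ≟ˢ E ] λ G → [ H″.𝓔? G ] * [ h[ G ] ≟ˢ F ])
         (∑-cong Gs λ G → *-assoc [ H″.𝓔? G ] [ h[ G ] ≟ˢ F ] [ g[ F ] ≟ˢ E ])) ⟩
  ∑[ F ∈ Fs ] ∑[ G ∈ Gs ] ([ H″.𝓔? G ] * ([ h[ G ] ≟ˢ F ] * [ g[ F ] ≟ˢ E ]))
    ≡⟨ ∑-swap Fs Gs (λ F G → [ H″.𝓔? G ] * ([ h[ G ] ≟ˢ F ] * [ g[ F ] ≟ˢ E ])) ⟩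
  ∑[ G ∈ Gs ] ∑[ F ∈ Fs ] ([ H″.𝓔? G ] * ([ h[ G ] ≟ˢ F ] * [ g[ F ] ≟ˢ E ]))
    ≡⟨ ∑-cong Gs (λ G → sym (∑-*ˡ Fs [ H″.𝓔? G ] λ F →
         [ h[ G ] ≟ˢ F ] * [ g[ F ] ≟ˢ E ])) ⟩
  ∑[ G ∈ Gs ] ([ H″.𝓔? G ] * ∑[ F ∈ Fs ] ([ h[ G ] ≟ˢ F ] * [ g[ F ] ≟ˢ E ]))
    -- For fixed `G`, the delta leaves only the term `F = h[ G ]`, so the middle hypergraph
    -- disappears.
    ≡⟨ ∑-cong Gs (λ G → cong ([ H″.𝓔? G ] *_) (∑-subsets-δ h[ G ] λ F → [ g[ F ] ≟ˢ E ])) ⟩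
  ∑[ G ∈ Gs ] ([ H″.𝓔? G ] * [ g[ h[ G ] ] ≟ˢ E ])
    ≡⟨ ∑-cong Gs (λ G → cong (λ F → [ H″.𝓔? G ] * [ F ≟ˢ E ]) (image-∘ ℋ″ ℋ′ ℋ h g G)) ⟩
  pushforward ℋ″ ℋ (g ∘ h) E ∎
  where
  module H″ = Hypergraph ℋ″
  module H′ = Hypergraph ℋ′
  module H  = Hypergraph ℋ
  Fs = subsets H′.order
  Gs = subsets H″.order
  h[_] = image ℋ″ ℋ′ h
  g[_] = image ℋ′ ℋ g

lemma9 : (a : Level) → IsPreorder (_≡_ {A = Hypergraph a}) _⪯_
lemma9 a = record
  { isEquivalence = isEquivalence
  ; reflexive     = λ { {ℋ} refl → id , id-isQuotientMap ℋ }
  -- A witness of `ℋ ⪯ ℋ′` maps from `ℋ′` to `ℋ`, against the direction of the relation. Hence the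
  -- second witness `h` is applied first.
  ; trans         = λ { {ℋ} {ℋ′} {ℋ″} (g , g-quot) (h , h-quot) →
                        g ∘ h , ∘-isQuotientMap ℋ″ ℋ′ ℋ h g h-quot g-quot }
  }
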